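{- For any integer $n \geq 0$ (with $a$ denoting a nonnegative integer), $$v_2(B_n(4,2)) = \begin{cases} 1+v_2(a), & \text{if } n=5a \text{ and } v_2(a) \leq 5, \\ 1+ v_2 \big( a(a+1) \big), & \text{if } n = 5a+1 \text{ and } v_2 \big( a(a+1) \big) \leq 5, \\ 0, & \text{if } n \equiv 2 \pmod{5}, \\ 1 + v_2(a), & \text{if } n=5a+3 \text{ and } v_2(a) \leq 4, \\ 0, & \text{if } n \equiv 4 \pmod{5}. \end{cases}$$ (No assertion is made for values of $n$ not covered by these cases.)
   Context: The sequence $\{B_n(4,2)\}_{n\geq 0}$ is defined by $B_n = B_{n-1}+B_{n-2}+B_{n-3}+B_{n-4}$ for $n \geq 4$, with $(B_0,B_1,B_2,B_3)=(0,0,1,0)$. $v_2$ denotes the 2-adic order (2-adic valuation), with the convention $v_2(0)=+\infty$. -}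

module Defs where

open import Data.Maybe.Base using (zipWith)
open import Data.Nat
open import Data.Nat.Divisibility
open import Data.Nat.Properties
open import Function.Bundles using (_⇔_; mk⇔)
open import Relation.Binary.PropositionalEquality
  using (_≡_; refl; cong; sym; trans; subst)
open import Relation.Nullary using (yes; no; contradiction)
open import Relation.Nullary.Construct.Add.Supremum public
  using () renaming (_⁺ to infix 8 _⁺; ⊤⁺ to ∞; [_] to fin)
open import Relation.Unary using (Pred; Decidable)
open import Relation.Binary.Construct.Add.Supremum.NonStrict _≤_ public
  using ([_]; _≤⊤⁺) renaming (_≤⁺_ to infix 4 _≤∞_)

ℕ∞ : Set
ℕ∞ = ℕ ⁺

infixl 6 _+∞_
_+∞_ : ℕ∞ → ℕ∞ → ℕ∞
_+∞_ = zipWith _+_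

-- The sequence B_n(4,2).
B : ℕ → ℕ
B 0 = 0
B 1 = 0
B 2 = 1
B 3 = 0
B (suc (suc (suc (suc n)))) =
  B (suc (suc (suc n))) + B (suc (suc n)) + B (suc n) + B n

-- Greatest k ≤ b satisfying P, or 0 if there is none.
greatest : ∀ {p} {P : Pred ℕ p} → Decidable P → ℕ → ℕ
greatest P? zero = 0
greatest P? (suc b) with P? (suc b)
... | yes _ = suc b
... | no  _ = greatest P? b

-- For m ≥ 1 the search bound m loses nothing, since 2 ^ k ∣ m forces
-- k < 2 ^ k ≤ m; v₂-spec below makes this precise.
v₂ : ℕ → ℕ∞
v₂ zero      = ∞
v₂ m@(suc _) = fin (greatest (λ k → 2 ^ k ∣? m) m)

greatest-holds : ∀ {p} {P : Pred ℕ p} (P? : Decidable P) → P 0 →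
                 ∀ b → P (greatest P? b)
greatest-holds P? p₀ zero = p₀
greatest-holds P? p₀ (suc b) with P? (suc b)
... | yes p = p
... | no  _ = greatest-holds P? p₀ b

greatest-max : ∀ {p} {P : Pred ℕ p} (P? : Decidable P) →
               ∀ b {k} → k ≤ b → P k → k ≤ greatest P? b
greatest-max P? zero    k≤b pk = k≤b
greatest-max P? (suc b) k≤b pk with P? (suc b)
... | yes _ = k≤b
... | no ¬p = greatest-max P? b
  (s≤s⁻¹ (≤∧≢⇒< k≤b λ { refl → contradiction pk ¬p })) pk

n<2^n : ∀ n → n < 2 ^ n
n<2^n zero    = s≤s z≤n
n<2^n (suc n) = begin
  1 + suc n      ≤⟨ +-mono-≤ (m^n>0 2 n) (n<2^n n) ⟩
  2 ^ n + 2 ^ n  ≡⟨ cong (2 ^ n +_) (+-identityʳ (2 ^ n)) ⟨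
  2 ^ suc n      ∎
  where open ≤-Reasoning

2^-mono-∣ : ∀ {j k} → j ≤ k → 2 ^ j ∣ 2 ^ k
2^-mono-∣ {j} {k} j≤k = subst (2 ^ j ∣_)
  (trans (sym (^-distribˡ-+-* 2 j (k ∸ j))) (cong (2 ^_) (m+[n∸m]≡n j≤k)))
  (m∣m*n (2 ^ (k ∸ j)))

v₂-spec : ∀ m k → fin k ≤∞ v₂ m ⇔ 2 ^ k ∣ m
v₂-spec zero      k = mk⇔ (λ _ → _ ∣0) (λ _ → _ ≤⊤⁺)
v₂-spec m@(suc _) k = mk⇔
  (λ { [ k≤v ] → ∣-trans (2^-mono-∣ k≤v)
                   (greatest-holds (λ j → 2 ^ j ∣? m) (1∣ m) m) })
  (λ d → [ greatest-max (λ j → 2 ^ j ∣? m) m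
             (≤-trans (<⇒≤ (n<2^n k)) (∣⇒≤ d)) d ])

{-# OPTIONS --safe #-}

-- Modulo 128 the window (B n, B (n+1), B (n+2), B (n+3)) evolves by a fixed
-- map, under which (0, 0, 1, 0) returns to itself after 320 = 5 · 64 steps.
-- Hence gcd (B (5a + c)) 128 depends only on a mod 64, and so do gcd (2a) 128
-- and gcd (2a(a + 1)) 128; comparing them is a check of 64 cases for each c.
-- Equality of these gcds determines every valuation below 7.
module Submission where

open import Defs
open import Data.Nat
  using (ℕ; zero; suc; _+_; _*_; _^_; _%_; _/_; _≤_; _<_; _≟_; s≤s; z<s; NonZero)
open import Data.Nat.Divisibility
open import Data.Nat.DivMod
open import Data.Nat.GCD using (gcd; gcd[m,n]∣m; gcd[m,n]∣n; gcd-greatest)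
open import Data.Nat.GeneralisedArithmetic using (fold; fold-+)
open import Data.Nat.Properties
open import Data.Nat.Tactic.RingSolver using (solve-∀)
open import Data.Product using (_×_; _,_; proj₁)
open import Function.Bundles using (module Equivalence)
open import Relation.Binary.PropositionalEquality
  using (_≡_; refl; sym; trans; cong; cong₂; subst; module ≡-Reasoning)
open import Relation.Nullary using (Dec; ¬_; contradiction)
open import Relation.Nullary.Decidable using (toWitness)

2^∣⇒≤v₂ : ∀ {m j k} → v₂ m ≡ fin j → 2 ^ k ∣ m → k ≤ j
2^∣⇒≤v₂ {m} {k = k} eq d
  with [ k≤j ] ← subst (fin k ≤∞_) eq (Equivalence.from (v₂-spec m k) d) = k≤j

2^v₂∣ : ∀ {m j} → v₂ m ≡ fin j → 2 ^ j ∣ m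
2^v₂∣ {m} {j} eq =
  Equivalence.to (v₂-spec m j) (subst (fin j ≤∞_) (sym eq) [ ≤-refl ])

-- The second hypothesis also rules out `m = 0`, which every power of 2 divides.
v₂-exact : ∀ {m j} → 2 ^ j ∣ m → ¬ 2 ^ suc j ∣ m → v₂ m ≡ fin j
v₂-exact {zero}      d ¬d = contradiction (_ ∣0) ¬d
v₂-exact {m@(suc _)} {j} d ¬d = cong fin (≤-antisym
  (≮⇒≥ λ j<v → ¬d (∣-trans (2^-mono-∣ j<v) (2^v₂∣ refl)))
  (2^∣⇒≤v₂ refl d))

v₂-double : ∀ {m j} → v₂ m ≡ fin j → v₂ (2 * m) ≡ fin (suc j)
v₂-double eq = v₂-exact (*-monoʳ-∣ 2 (2^v₂∣ eq))
  (λ d → 1+n≰n (2^∣⇒≤v₂ eq (*-cancelˡ-∣ 2 d)))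

∣-transfer-gcd : ∀ {d e m n} → gcd m e ≡ gcd n e → d ∣ e → d ∣ m → d ∣ n
∣-transfer-gcd {d} {e} {m} {n} eq d∣e d∣m = ∣-trans
  (subst (d ∣_) eq (gcd-greatest d∣m d∣e)) (gcd[m,n]∣m n e)

-- For `i ≤ k`, `2 ^ i` divides a number exactly when it divides its gcd with `2 ^ k`. Pinning the
-- valuation to `j` tests `i = j` and `i = suc j`, hence the strict `j < k`.
v₂-transfer-gcd : ∀ {m n j} k → gcd m (2 ^ k) ≡ gcd n (2 ^ k) → j < k →
                  v₂ n ≡ fin j → v₂ m ≡ fin j
v₂-transfer-gcd k eq j<k v = v₂-exact
  (∣-transfer-gcd (sym eq) (2^-mono-∣ (<⇒≤ j<k)) (2^v₂∣ v))
  (λ d → 1+n≰n (2^∣⇒≤v₂ v (∣-transfer-gcd eq (2^-mono-∣ j<k) d)))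

v₂-transfer-gcd-double : ∀ {m n b} k → gcd m (2 ^ k) ≡ gcd (2 * n) (2 ^ k) →
                         suc b < k → v₂ n ≤∞ fin b → v₂ m ≡ fin 1 +∞ v₂ n
v₂-transfer-gcd-double {n = n} k eq 1+b<k v≤b with v₂ n in v | v≤b
-- Nothing finite bounds `∞`, so matching on `[ j≤b ]` makes `v₂ n` a finite `j`; doubling raises it
-- to `suc j`.
... | _ | [ j≤b ] = v₂-transfer-gcd k eq (≤-<-trans (s≤s j≤b) 1+b<k) (v₂-double v)

gcd-cong-% : ∀ m n d .{{_ : NonZero d}} → m % d ≡ n % d → gcd m d ≡ gcd n d
gcd-cong-% m n d eq = ∣-antisym (half m n eq) (half n m (sym eq))
  where
  half : ∀ x y → x % d ≡ y % d → gcd x d ∣ gcd y d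
  half x y e = gcd-greatest
    (∣n∣m%n⇒∣m g∣d (subst (gcd x d ∣_) e (%-presˡ-∣ (gcd[m,n]∣m x d) g∣d))) g∣d
    where g∣d = gcd[m,n]∣n x d

%-distrib-+₄ : ∀ w x y z d .{{_ : NonZero d}} →
               (w + x + y + z) % d ≡ (w % d + x % d + y % d + z % d) % d
%-distrib-+₄ w x y z d =
  extend (w + x + y) (w % d + x % d + y % d) z
    (extend (w + x) (w % d + x % d) y
      (extend w (w % d) x (sym (m%n%n≡m%n w d))))
  where
  open ≡-Reasoning
  extend : ∀ m m′ n → m % d ≡ m′ % d → (m + n) % d ≡ (m′ + n % d) % d
  extend m m′ n eq = begin
    (m + n) % d               ≡⟨ %-distribˡ-+ m n d ⟩
    (m % d + n % d) % d       ≡⟨ cong₂ (λ k l → (k + l) % d) eq (sym (m%n%n≡m%n n d)) ⟩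
    (m′ % d + n % d % d) % d  ≡⟨ %-distribˡ-+ m′ (n % d) d ⟨
    (m′ + n % d) % d          ∎

Window : Set
Window = ℕ × ℕ × ℕ × ℕ

step : Window → Window
step (p , q , r , s) = q , r , s , (s + r + q + p) % 128

-- Serves to evaluate `B` modulo 128: each step costs one sum of small numbers, while unfolding `B`
-- itself branches four ways.
orbit : ℕ → Window
orbit = fold (0 , 0 , 1 , 0) step

window : ℕ → Window
window n = B n % 128 , B (1 + n) % 128 , B (2 + n) % 128 , B (3 + n) % 128

window-suc : ∀ n → window (suc n) ≡ step (window n)
-- Three entries shift by definition; only the new fourth one uses the recurrence.
window-suc n = cong (λ x → B (1 + n) % 128 , B (2 + n) % 128 , B (3 + n) % 128 , x)
  (%-distrib-+₄ (B (3 + n)) (B (2 + n)) (B (1 + n)) (B n) 128)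

window≡orbit : ∀ n → window n ≡ orbit n
window≡orbit zero    = refl
window≡orbit (suc n) = trans (window-suc n) (cong step (window≡orbit n))

B≡orbit : ∀ n → B n % 128 ≡ proj₁ (orbit n)
B≡orbit n = cong proj₁ (window≡orbit n)

orbit-320 : orbit 320 ≡ orbit 0
orbit-320 = refl

-- The period is added on the right: B (320 + n) would unfold exponentially.
B-period : ∀ n → B (n + 320) % 128 ≡ B n % 128
B-period n = begin
  B (n + 320) % 128                 ≡⟨ B≡orbit (n + 320) ⟩
  proj₁ (orbit (n + 320))           ≡⟨ cong proj₁ (fold-+ _ step n) ⟩
  proj₁ (fold (orbit 320) step n)   ≡⟨ cong (λ w → proj₁ (fold w step n)) orbit-320 ⟩
  proj₁ (orbit n)                   ≡⟨ B≡orbit n ⟨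
  B n % 128                         ∎
  where open ≡-Reasoning

%-periodic : ∀ {A : Set} (f : ℕ → A) d .{{_ : NonZero d}} →
             (∀ n → f (n + d) ≡ f n) → ∀ n → f n ≡ f (n % d)
%-periodic f d period n =
  trans (cong f (m≡m%n+[m/n]*n n d)) (multiple (n / d) (n % d))
  where
  multiple : ∀ k r → f (r + k * d) ≡ f r
  multiple zero    r = cong f (+-identityʳ r)
  -- One period moves from the multiple into the remainder, which is why `r` varies in the
  -- induction.
  multiple (suc k) r = trans (cong f (sym (+-assoc r d (k * d))))
                             (trans (multiple k (r + d)) (period r))

gcd-periodic : ∀ (f : ℕ → ℕ) k d .{{_ : NonZero k}} .{{_ : NonZero d}} →
               (∀ n → f (n + k) % d ≡ f n % d) →
               ∀ n → gcd (f n) d ≡ gcd (f (n % k)) d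
gcd-periodic f k d period = %-periodic (λ n → gcd (f n) d) k
  (λ n → gcd-cong-% (f (n + k)) (f n) d (period n))

-- Phrased with `orbit` instead of `B` so that the decision procedure can be run during type
-- checking.
AgreeBelow64 : ℕ → (ℕ → ℕ) → Set
AgreeBelow64 c f = ∀ {a} → a < 64 → gcd (proj₁ (orbit (5 * a + c))) 128 ≡ gcd (f a) 128

agreeBelow64? : ∀ c f → Dec (AgreeBelow64 c f)
agreeBelow64? c f = allUpTo? (λ a → gcd (proj₁ (orbit (5 * a + c))) 128 ≟ gcd (f a) 128) 64

-- Adding 64 to `a` adds the full period 320 to `5 * a + c`, so both gcds depend only on `a % 64`,
-- where `agree` compares them.
gcd-B : ∀ c (f : ℕ → ℕ) → (∀ a → f (a + 64) % 128 ≡ f a % 128) → AgreeBelow64 c f →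
        ∀ a → gcd (B (5 * a + c)) 128 ≡ gcd (f a) 128
gcd-B c f period agree a = begin
  gcd (B (5 * a + c)) 128              ≡⟨ gcd-periodic (λ x → B (5 * x + c)) 64 128 B-period₆₄ a ⟩
  gcd (B b) 128                        ≡⟨ gcd-cong-% (B b % 128) (B b) 128 (m%n%n≡m%n (B b) 128) ⟨
  gcd (B b % 128) 128                  ≡⟨ cong (λ x → gcd x 128) (B≡orbit b) ⟩
  gcd (proj₁ (orbit b)) 128            ≡⟨ agree (m%n<n a 64) ⟩
  gcd (f (a % 64)) 128                 ≡⟨ gcd-periodic f 64 128 period a ⟨
  gcd (f a) 128                        ∎
  where
  open ≡-Reasoning
  b = 5 * (a % 64) + c
  shift : ∀ a c → 5 * (a + 64) + c ≡ 5 * a + c + 320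
  shift = solve-∀
  B-period₆₄ : ∀ a → B (5 * (a + 64) + c) % 128 ≡ B (5 * a + c) % 128
  B-period₆₄ a = trans (cong (λ n → B n % 128) (shift a c)) (B-period (5 * a + c))

double-period : ∀ a → 2 * (a + 64) % 128 ≡ 2 * a % 128
double-period a = trans (cong (_% 128) (expand a)) ([m+kn]%n≡m%n (2 * a) 1 128)
  where
  expand : ∀ a → 2 * (a + 64) ≡ 2 * a + 1 * 128
  expand = solve-∀

pronic-period : ∀ a → 2 * ((a + 64) * (a + 64 + 1)) % 128 ≡ 2 * (a * (a + 1)) % 128
pronic-period a = trans (cong (_% 128) (expand a))
  -- `(a + 64) * (a + 65)` exceeds `a * (a + 1)` by `64 * (2 * a + 65)`; the factor 2 completes 128.
  ([m+kn]%n≡m%n (2 * (a * (a + 1))) (2 * a + 65) 128)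
  where
  expand : ∀ a → 2 * ((a + 64) * (a + 64 + 1)) ≡ 2 * (a * (a + 1)) + (2 * a + 65) * 128
  expand = solve-∀

gcd-B₀ : ∀ a → gcd (B (5 * a + 0)) 128 ≡ gcd (2 * a) 128
gcd-B₀ = gcd-B 0 (2 *_) double-period
  (toWitness {a? = agreeBelow64? 0 (2 *_)} _)

gcd-B₁ : ∀ a → gcd (B (5 * a + 1)) 128 ≡ gcd (2 * (a * (a + 1))) 128
gcd-B₁ = gcd-B 1 (λ a → 2 * (a * (a + 1))) pronic-period
  (toWitness {a? = agreeBelow64? 1 (λ a → 2 * (a * (a + 1)))} _)

-- A gcd of 1 with 128 expresses oddness, so the comparison function is constantly 1.
gcd-B₂ : ∀ a → gcd (B (5 * a + 2)) 128 ≡ 1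
gcd-B₂ = gcd-B 2 (λ _ → 1) (λ _ → refl)
  (toWitness {a? = agreeBelow64? 2 (λ _ → 1)} _)

gcd-B₃ : ∀ a → gcd (B (5 * a + 3)) 128 ≡ gcd (2 * a) 128
gcd-B₃ = gcd-B 3 (2 *_) double-period
  (toWitness {a? = agreeBelow64? 3 (2 *_)} _)

gcd-B₄ : ∀ a → gcd (B (5 * a + 4)) 128 ≡ 1
gcd-B₄ = gcd-B 4 (λ _ → 1) (λ _ → refl)
  (toWitness {a? = agreeBelow64? 4 (λ _ → 1)} _)

n≡5[n/5]+n%5 : ∀ n → n ≡ 5 * (n / 5) + n % 5
n≡5[n/5]+n%5 n = begin
  n                    ≡⟨ m≡m%n+[m/n]*n n 5 ⟩
  n % 5 + n / 5 * 5    ≡⟨ +-comm (n % 5) (n / 5 * 5) ⟩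
  n / 5 * 5 + n % 5    ≡⟨ cong (_+ n % 5) (*-comm (n / 5) 5) ⟩
  5 * (n / 5) + n % 5  ∎
  where open ≡-Reasoning

v₂-B-odd : ∀ n c → (∀ a → gcd (B (5 * a + c)) 128 ≡ 1) → n % 5 ≡ c → v₂ (B n) ≡ fin 0
-- The valuation is carried over from 1, where both `gcd 1 128` and `v₂ 1` evaluate.
v₂-B-odd n c coprime refl = v₂-transfer-gcd {n = 1} 7
  (trans (cong (λ m → gcd (B m) 128) (n≡5[n/5]+n%5 n)) (coprime (n / 5)))
  z<s refl

theorem15 : (n : ℕ) →
    (∀ a → n ≡ 5 * a → v₂ a ≤∞ fin 5 → v₂ (B n) ≡ fin 1 +∞ v₂ a)
    × (∀ a → n ≡ 5 * a + 1 → v₂ (a * (a + 1)) ≤∞ fin 5 → v₂ (B n) ≡ fin 1 +∞ v₂ (a * (a + 1)))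
    × (n % 5 ≡ 2 → v₂ (B n) ≡ fin 0)
    × (∀ a → n ≡ 5 * a + 3 → v₂ a ≤∞ fin 4 → v₂ (B n) ≡ fin 1 +∞ v₂ a)
    × (n % 5 ≡ 4 → v₂ (B n) ≡ fin 0)
theorem15 n =
    (λ { a refl → v₂-transfer-gcd-double 7
           (trans (cong (λ m → gcd (B m) 128) (sym (+-identityʳ (5 * a)))) (gcd-B₀ a))
           -- The bound 5 requires `6 < 7`, that is `7 ≤ 7`: this is what fixes the modulus at
           -- `2 ^ 7 = 128`.
           ≤-refl })
  , (λ { a refl → v₂-transfer-gcd-double 7 (gcd-B₁ a) ≤-refl })
  , v₂-B-odd n 2 gcd-B₂
  -- With the bound 4 the requirement is `5 < 7`, that is `6 ≤ 7`.
  , (λ { a refl → v₂-transfer-gcd-double 7 (gcd-B₃ a) (n≤1+n 6) })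
  , v₂-B-odd n 4 gcd-B₄
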